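{- For every stable allocation instance with rational data and every given feasible rational allocation $x$, there is a finite sequence of best response steps starting from $x$ that leads to a stable allocation.
   Context: A stable allocation instance consists of a bipartite graph $G=(V,E)$ with color classes $J$ (jobs, the active side) and $M$ (machines, the passive side), quotas $q:V\to\mathbb{R}_{\ge 0}$, edge capacities $c:E\to\mathbb{R}_{\ge 0}$, and for every vertex $v$ a strict ranking $\mathrm{rank}_v$ of its incident edges ($uv$ dominates $wv$ at $v$ if $\mathrm{rank}_v(uv)<\mathrm{rank}_v(wv)$). An allocation is $x:E\to\mathbb{R}_{\ge0}$ with $x(e)\le c(e)$ and $x(v):=\sum_{e\in\delta(v)}x(e)\le q(v)$. Write $\bar x(e)=c(e)-x(e)$, $\bar x(v)=q(v)-x(v)$. An edge $jm$ blocks $x$ if (1) $x(jm)<c(jm)$; (2) $x(j)<q(j)$ or $j$ prefers $jm$ to its worst edge with positive value in $x$; (3) $x(m)<q(m)$ or $m$ prefers $jm$ to its worst edge with positive value in $x$. An allocation is stable if no edge blocks it. A best response step of a job $j$ having blocking edges: let $jm$ be the blocking edge of $j$ ranked highest by $j$; $x(jm)$ is increased by $A:=\min\{\bar x(j)+x(\text{edges dominated by }jm\text{ at }j),\ \bar x(jm),\ \bar x(m)+x(\text{edges dominated by }jm\text{ at }m)\}$, after which $j$ and $m$ each first use their free quota and then reduce allocation on their worst allocated edges until the allocation is feasible again. -}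

module Defs where

open import Data.Nat as ℕ using (ℕ; zero; suc)
open import Data.Fin using (Fin; zero; suc)
import Data.Fin.Properties as FinP
import Data.Nat.Properties as ℕP
open import Data.Rational using (ℚ; 0ℚ; _+_; _-_; _⊓_; _⊔_; _≤_; _<_)
open import Data.Bool using (Bool; true; false; if_then_else_; _∧_)
open import Data.Product using (Σ; ∃; _×_; _,_)
open import Data.Sum using (_⊎_)
open import Function using (_∘_)
open import Relation.Binary.PropositionalEquality using (_≡_)
open import Relation.Nullary.Decidable using (⌊_⌋)
open import Relation.Binary.Construct.Closure.ReflexiveTransitive using (Star)

sumIf : ∀ {n} → (Fin n → Bool) → (Fin n → ℚ) → ℚ
sumIf {zero}  p f = 0ℚ
sumIf {suc n} p f = (if p zero then f zero else 0ℚ) + sumIf (p ∘ suc) (f ∘ suc)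

-- A stable allocation instance with rational data.
-- Jobs are Fin nJ, machines Fin nM, edges Fin nE; edge e joins the job
-- (job e) and the machine (mach e).  rankJ e is the rank of e at its job,
-- rankM e the rank of e at its machine (smaller rank = more preferred).

record Instance : Set where
  field
    nJ nM nE : ℕ
    job   : Fin nE → Fin nJ
    mach  : Fin nE → Fin nM
    qJ    : Fin nJ → ℚ
    qM    : Fin nM → ℚ
    cap   : Fin nE → ℚ
    rankJ : Fin nE → ℕ
    rankM : Fin nE → ℕ

record WellFormed (I : Instance) : Set where
  open Instance I
  field
    simple    : ∀ e e' → job e ≡ job e' → mach e ≡ mach e' → e ≡ e'
    qJ-nonneg : ∀ j → 0ℚ ≤ qJ j
    qM-nonneg : ∀ m → 0ℚ ≤ qM m
    cap-nonneg : ∀ e → 0ℚ ≤ cap e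
    rankJ-strict : ∀ e e' → job e ≡ job e' → rankJ e ≡ rankJ e' → e ≡ e'
    rankM-strict : ∀ e e' → mach e ≡ mach e' → rankM e ≡ rankM e' → e ≡ e'

module _ (I : Instance) where
  open Instance I

  Allocation : Set
  Allocation = Fin nE → ℚ

  loadJ : Allocation → Fin nJ → ℚ
  loadJ x j = sumIf (λ e → ⌊ job e FinP.≟ j ⌋) x

  loadM : Allocation → Fin nM → ℚ
  loadM x m = sumIf (λ e → ⌊ mach e FinP.≟ m ⌋) x

  Feasible : Allocation → Set
  Feasible x = (∀ e → 0ℚ ≤ x e) × (∀ e → x e ≤ cap e)
             × (∀ j → loadJ x j ≤ qJ j) × (∀ m → loadM x m ≤ qM m)

  Blocks : Allocation → Fin nE → Set
  Blocks x e =
    x e < cap e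
    × (loadJ x (job e) < qJ (job e)
       ⊎ Σ (Fin nE) (λ e' → job e' ≡ job e × 0ℚ < x e' × rankJ e ℕ.< rankJ e'))
    × (loadM x (mach e) < qM (mach e)
       ⊎ Σ (Fin nE) (λ e' → mach e' ≡ mach e × 0ℚ < x e' × rankM e ℕ.< rankM e'))

  Stable : Allocation → Set
  Stable x = ∀ e → Blocks x e → Data.Empty.⊥
    where import Data.Empty

  bestResponseUpdate : Allocation → Fin nE → Allocation
  bestResponseUpdate x e0 e =
    if ⌊ e FinP.≟ e0 ⌋ then x e + A
    else if ⌊ job e FinP.≟ j ⌋ then x e - (x e ⊓ (0ℚ ⊔ (Rj - worseJ)))
    else if ⌊ mach e FinP.≟ m ⌋ then x e - (x e ⊓ (0ℚ ⊔ (Rm - worseM)))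
    else x e
    where
    j = job e0
    m = mach e0
    domJ = sumIf (λ f → ⌊ job f FinP.≟ j ⌋ ∧ ⌊ rankJ e0 ℕP.<? rankJ f ⌋) x
    domM = sumIf (λ f → ⌊ mach f FinP.≟ m ⌋ ∧ ⌊ rankM e0 ℕP.<? rankM f ⌋) x
    A = ((qJ j - loadJ x j) + domJ) ⊓ ((cap e0 - x e0) ⊓ ((qM m - loadM x m) + domM))
    -- amount that must be removed at j (resp. m) after using free quota
    Rj = 0ℚ ⊔ (A - (qJ j - loadJ x j))
    Rm = 0ℚ ⊔ (A - (qM m - loadM x m))
    worseJ = sumIf (λ f → ⌊ job f FinP.≟ j ⌋ ∧ ⌊ rankJ e ℕP.<? rankJ f ⌋) x
    worseM = sumIf (λ f → ⌊ mach f FinP.≟ m ⌋ ∧ ⌊ rankM e ℕP.<? rankM f ⌋) x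

  BRStep : Allocation → Allocation → Set
  BRStep x y = Σ (Fin nE) λ e0 →
      Blocks x e0
    × (∀ e → job e ≡ job e0 → Blocks x e → rankJ e0 ℕ.≤ rankJ e)
    × (∀ e → y e ≡ bestResponseUpdate x e0 e)

  BRSteps : Allocation → Allocation → Set
  BRSteps = Star BRStep

{-# OPTIONS --safe #-}
module Submission where

open import Defs
open import Algebra.Bundles using (CommutativeMonoid)
import Algebra.Properties.CommutativeSemigroup as CommutativeSemigroupProperties
open import Data.Bool using (Bool; true; false; if_then_else_; _∧_)
open import Data.Empty using (⊥)
open import Data.Fin using (Fin; zero; suc)
import Data.Fin.Properties as FinP
import Data.Integer as ℤ
open import Data.Integer using (ℤ; +≤+; +<+; -≤+; -<+)
import Data.Integer.Properties as ℤP
open import Data.Nat as ℕ using (ℕ; zero; suc; z≤n; s≤s)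
import Data.Nat.Coprimality as Coprime
import Data.Nat.Properties as ℕP
open import Data.Product using (Σ; _×_; _,_; proj₁; proj₂)
open import Data.Product.Relation.Binary.Lex.Strict using (×-Lex; ×-wellFounded)
open import Data.Rational using (ℚ; mkℚ; toℚᵘ; 0ℚ; _+_; _-_; -_; _*_; _⊓_; _⊔_; _≤_; _<_; *≤*; *<*;
  Positive; positive; nonNegative)
open import Data.Rational.Properties
open import Data.Rational.Solver using (module +-*-Solver)
import Data.Rational.Unnormalised as ℚᵘ
import Data.Rational.Unnormalised.Properties as ℚᵘP
open import Data.Sum using (_⊎_; inj₁; inj₂; [_,_]′)
open import Function using (_∘_; case_of_; _on_)
open import Induction.WellFounded using (Acc; acc; WellFounded)
import Relation.Binary.Construct.On as On
open import Relation.Binary.Construct.Closure.ReflexiveTransitive using (ε; _◅_; _◅◅_)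
open import Relation.Binary.PropositionalEquality
open import Relation.Nullary using (¬_; Dec; yes; no; contradiction)
open import Relation.Nullary.Decidable using (⌊_⌋; _×-dec_; _⊎-dec_; toSum)
open +-*-Solver
open CommutativeSemigroupProperties (CommutativeMonoid.commutativeSemigroup +-0-commutativeMonoid)
  using (interchange; x∙yz≈y∙xz)

-- Phase one: only jobs j with a blocking edge better than some positive edge of j respond.
-- Sum over the edges e the value cap e if the job of e has a worse positive edge, and x e
-- otherwise.  Such a response never raises this potential, and lowers it whenever j has to
-- reduce its worst edge; if j lives on its free quota, the rank-weighted welfare of the
-- machines goes up instead.
-- Phase two: no blocking edge is better than a positive edge of its job.  Responses use only
-- free quota, so the welfare of the machines goes up, and no such edge reappears: an edge cut
-- at a machine is refused by it afterwards, and the responding job took its best blocking edge.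
-- Both phases stop because all rational data lie on one grid (1/N)ℤ.

-- Rational inequalities and Boolean tests.

private variable n : ℕ

p≤q⇒0≤q-p : ∀ {p q} → p ≤ q → 0ℚ ≤ q - p
p≤q⇒0≤q-p {p} {q} p≤q = subst (_≤ q - p) (+-inverseʳ p) (+-monoˡ-≤ (- p) p≤q)

p<q⇒0<q-p : ∀ {p q} → p < q → 0ℚ < q - p
p<q⇒0<q-p {p} {q} p<q = subst (_< q - p) (+-inverseʳ p) (+-monoˡ-< (- p) p<q)

≤-by-difference : ∀ {p q} r → q ≡ p + r → 0ℚ ≤ r → p ≤ q
≤-by-difference {p} r refl 0≤r = subst (_≤ p + r) (+-identityʳ p) (+-monoʳ-≤ p 0≤r)

<-by-difference : ∀ {p q} r → q ≡ p + r → 0ℚ < r → p < q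
<-by-difference {p} r refl 0<r = subst (_< p + r) (+-identityʳ p) (+-monoʳ-< p 0<r)

⊓-glb-< : ∀ {p q r} → p < q → p < r → p < q ⊓ r
⊓-glb-< {p} {q} {r} p<q p<r with ⊓-sel q r
... | inj₁ eq = subst (p <_) (sym eq) p<q
... | inj₂ eq = subst (p <_) (sym eq) p<r

-- One edge of a greedy removal: `r` is the amount to remove, `s` what the worse edges hold, `a`
-- what this edge holds. Either the worse edges already cover `r` and this edge loses nothing, or
-- they are emptied and this edge pays the remainder as far as it can.
greedy-step : ∀ r s a → 0ℚ ≤ a → (a ⊓ (0ℚ ⊔ (r - s))) + (r ⊓ s) ≡ r ⊓ (a + s)
greedy-step r s a 0≤a with ≤-total r s
... | inj₁ r≤s = begin
  (a ⊓ (0ℚ ⊔ (r - s))) + (r ⊓ s)  ≡⟨ cong₂ (λ u v → (a ⊓ u) + v) (p≥q⇒p⊔q≡p r-s≤0) (p≤q⇒p⊓q≡p r≤s) ⟩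
  (a ⊓ 0ℚ) + r                    ≡⟨ cong (_+ r) (p≥q⇒p⊓q≡q 0≤a) ⟩
  0ℚ + r                          ≡⟨ +-identityˡ r ⟩
  r                               ≡⟨ sym (p≤q⇒p⊓q≡p (≤-trans r≤s (≤-by-difference a (+-comm a s) 0≤a))) ⟩
  r ⊓ (a + s)                     ∎
  where
  open ≡-Reasoning
  r-s≤0 : r - s ≤ 0ℚ
  r-s≤0 = ≤-by-difference (s - r) (solve 2 (λ r s → con 0ℚ := (r :- s) :+ (s :- r)) refl r s) (p≤q⇒0≤q-p r≤s)
... | inj₂ s≤r = begin
  (a ⊓ (0ℚ ⊔ (r - s))) + (r ⊓ s)  ≡⟨ cong₂ (λ u v → (a ⊓ u) + v) (p≤q⇒p⊔q≡q (p≤q⇒0≤q-p s≤r)) (p≥q⇒p⊓q≡q s≤r) ⟩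
  (a ⊓ (r - s)) + s               ≡⟨ mono-≤-distrib-⊓ (+-monoˡ-≤ s) a (r - s) ⟩
  (a + s) ⊓ ((r - s) + s)         ≡⟨ cong ((a + s) ⊓_) (solve 2 (λ r s → (r :- s) :+ s := r) refl r s) ⟩
  (a + s) ⊓ r                     ≡⟨ ⊓-comm (a + s) r ⟩
  r ⊓ (a + s)                     ∎
  where open ≡-Reasoning

isYes-true : ∀ {ℓ} {P : Set ℓ} (d : Dec P) → P → ⌊ d ⌋ ≡ true
isYes-true (yes _) _ = refl
isYes-true (no ¬p) p = contradiction p ¬p

isYes-false : ∀ {ℓ} {P : Set ℓ} (d : Dec P) → ¬ P → ⌊ d ⌋ ≡ false
isYes-false (yes p) ¬p = contradiction p ¬p
isYes-false (no _) _ = refl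

isYes-witness : ∀ {ℓ} {P : Set ℓ} (d : Dec P) → ⌊ d ⌋ ≡ true → P
isYes-witness (yes p) _ = p

∧-true : ∀ {a b} → a ≡ true → b ≡ true → a ∧ b ≡ true
∧-true refl refl = refl

∧-trueˡ : ∀ a {b} → a ∧ b ≡ true → a ≡ true
∧-trueˡ true _ = refl

∧-trueʳ : ∀ a {b} → a ∧ b ≡ true → b ≡ true
∧-trueʳ true eq = eq

true⇔⇒≡ : ∀ a b → (a ≡ true → b ≡ true) → (b ≡ true → a ≡ true) → a ≡ b
true⇔⇒≡ false false _ _ = refl
true⇔⇒≡ false true  _ g = g refl
true⇔⇒≡ true  b     f _ = sym (f refl)

-- Sums over a filter.

sumIf-mono-≤ : (p : Fin n → Bool) {f g : Fin n → ℚ} →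
  (∀ e → p e ≡ true → f e ≤ g e) → sumIf p f ≤ sumIf p g
sumIf-mono-≤ {zero}  p f≤g = ≤-refl
sumIf-mono-≤ {suc n} p {f} {g} f≤g = +-mono-≤ head (sumIf-mono-≤ (p ∘ suc) (f≤g ∘ suc))
  where
  head : (if p zero then f zero else 0ℚ) ≤ (if p zero then g zero else 0ℚ)
  head with p zero | f≤g zero
  ... | true  | h = h refl
  ... | false | _ = ≤-refl

sumIf-mono-⊆ : (p q : Fin n → Bool) {f : Fin n → ℚ} → (∀ e → 0ℚ ≤ f e) →
  (∀ e → p e ≡ true → q e ≡ true) → sumIf p f ≤ sumIf q f
sumIf-mono-⊆ {zero}  p q 0≤f p⊆q = ≤-refl
sumIf-mono-⊆ {suc n} p q {f} 0≤f p⊆q =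
  +-mono-≤ head (sumIf-mono-⊆ (p ∘ suc) (q ∘ suc) (0≤f ∘ suc) (p⊆q ∘ suc))
  where
  head : (if p zero then f zero else 0ℚ) ≤ (if q zero then f zero else 0ℚ)
  head with p zero | q zero | p⊆q zero
  ... | true  | true  | _ = ≤-refl
  ... | true  | false | h = case h refl of λ ()
  ... | false | true  | _ = 0≤f zero
  ... | false | false | _ = ≤-refl

sumIf-cong : (p : Fin n → Bool) {f g : Fin n → ℚ} →
  (∀ e → p e ≡ true → f e ≡ g e) → sumIf p f ≡ sumIf p g
sumIf-cong p f≡g = ≤-antisym
  (sumIf-mono-≤ p (λ e pe → ≤-reflexive (f≡g e pe)))
  (sumIf-mono-≤ p (λ e pe → ≤-reflexive (sym (f≡g e pe))))

sumIf-congₚ : (p q : Fin n → Bool) {f : Fin n → ℚ} → (∀ e → p e ≡ q e) → sumIf p f ≡ sumIf q f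
sumIf-congₚ {zero}  p q p≡q = refl
sumIf-congₚ {suc n} p q {f} p≡q =
  cong₂ (λ b s → (if b then f zero else 0ℚ) + s) (p≡q zero) (sumIf-congₚ (p ∘ suc) (q ∘ suc) (p≡q ∘ suc))

sumIf-+ : (p : Fin n → Bool) (f g : Fin n → ℚ) →
  sumIf p (λ e → f e + g e) ≡ sumIf p f + sumIf p g
sumIf-+ {zero}  p f g = refl
sumIf-+ {suc n} p f g with p zero
... | true  = trans (cong ((f zero + g zero) +_) (sumIf-+ (p ∘ suc) (f ∘ suc) (g ∘ suc)))
  (interchange (f zero) (g zero) (sumIf (p ∘ suc) (f ∘ suc)) (sumIf (p ∘ suc) (g ∘ suc)))
... | false = trans (cong (0ℚ +_) (sumIf-+ (p ∘ suc) (f ∘ suc) (g ∘ suc)))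
  (interchange 0ℚ 0ℚ (sumIf (p ∘ suc) (f ∘ suc)) (sumIf (p ∘ suc) (g ∘ suc)))

sumIf-*ʳ : (p : Fin n → Bool) (f : Fin n → ℚ) (c : ℚ) → sumIf p (λ e → f e * c) ≡ sumIf p f * c
sumIf-*ʳ {zero}  p f c = sym (*-zeroˡ c)
sumIf-*ʳ {suc n} p f c with p zero
... | true  = trans (cong (f zero * c +_) (sumIf-*ʳ (p ∘ suc) (f ∘ suc) c)) (sym (*-distribʳ-+ c (f zero) _))
... | false = trans (cong (0ℚ +_) (sumIf-*ʳ (p ∘ suc) (f ∘ suc) c))
  (trans (+-identityˡ (rest * c)) (cong (_* c) (sym (+-identityˡ rest))))
  where rest = sumIf (p ∘ suc) (f ∘ suc)

sumIf-0 : (p : Fin n → Bool) {f : Fin n → ℚ} → (∀ e → p e ≡ true → f e ≡ 0ℚ) → sumIf p f ≡ 0ℚ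
sumIf-0 {n} p f≡0 = trans (sumIf-cong p f≡0) (zeros p)
  where
  zeros : ∀ {n} (p : Fin n → Bool) → sumIf p (λ _ → 0ℚ) ≡ 0ℚ
  zeros {zero}  p = refl
  zeros {suc n} p with p zero
  ... | true  = trans (cong (0ℚ +_) (zeros (p ∘ suc))) refl
  ... | false = trans (cong (0ℚ +_) (zeros (p ∘ suc))) refl

sumIf-nonneg : (p : Fin n → Bool) {f : Fin n → ℚ} → (∀ e → 0ℚ ≤ f e) → 0ℚ ≤ sumIf p f
sumIf-nonneg {n} p 0≤f = subst (_≤ sumIf p _) (sumIf-0 p (λ _ _ → refl)) (sumIf-mono-≤ p (λ e _ → 0≤f e))

sumIf-insert : (p q : Fin n → Bool) (f : Fin n → ℚ) (e₀ : Fin n) → p e₀ ≡ true → q e₀ ≡ false →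
  (∀ e → e ≢ e₀ → p e ≡ q e) → sumIf p f ≡ f e₀ + sumIf q f
sumIf-insert {suc n} p q f zero pe qe p≡q rewrite pe | qe =
  cong (f zero +_) (trans (sumIf-congₚ (p ∘ suc) (q ∘ suc) (λ e → p≡q (suc e) (λ ()))) (sym (+-identityˡ _)))
sumIf-insert {suc n} p q f (suc e₀) pe qe p≡q rewrite p≡q zero (λ ()) =
  trans (cong ((if q zero then f zero else 0ℚ) +_)
          (sumIf-insert (p ∘ suc) (q ∘ suc) (f ∘ suc) e₀ pe qe (λ e e≢ → p≡q (suc e) (e≢ ∘ FinP.suc-injective))))
    (x∙yz≈y∙xz (if q zero then f zero else 0ℚ) (f (suc e₀)) _)

-- A mass on one edge, written as a function on all edges so that it can be added to an allocation
-- and then summed by `sumIf-+`.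
point : Fin n → ℚ → Fin n → ℚ
point e₀ a e = if ⌊ e FinP.≟ e₀ ⌋ then a else 0ℚ

point-≡ : ∀ (e : Fin n) a → point e a e ≡ a
point-≡ e a rewrite isYes-true (e FinP.≟ e) refl = refl

point-≢ : ∀ {e e₀ : Fin n} a → e ≢ e₀ → point e₀ a e ≡ 0ℚ
point-≢ {e = e} {e₀} a e≢ rewrite isYes-false (e FinP.≟ e₀) e≢ = refl

sumIf-point : (p : Fin n → Bool) (e₀ : Fin n) (a : ℚ) → p e₀ ≡ true → sumIf p (point e₀ a) ≡ a
sumIf-point p e₀ a pe = begin
  sumIf p (point e₀ a)                    ≡⟨ sumIf-insert p others (point e₀ a) e₀ pe others-e₀ others-≢ ⟩
  point e₀ a e₀ + sumIf others (point e₀ a) ≡⟨ cong₂ _+_ (point-≡ e₀ a) (sumIf-0 others zero-off) ⟩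
  a + 0ℚ                                  ≡⟨ +-identityʳ a ⟩
  a                                       ∎
  where
  open ≡-Reasoning
  others : _ → Bool
  others e = if ⌊ e FinP.≟ e₀ ⌋ then false else p e
  others-e₀ : others e₀ ≡ false
  others-e₀ rewrite isYes-true (e₀ FinP.≟ e₀) refl = refl
  others-≢ : ∀ e → e ≢ e₀ → p e ≡ others e
  others-≢ e e≢ rewrite isYes-false (e FinP.≟ e₀) e≢ = refl
  zero-off : ∀ e → others e ≡ true → point e₀ a e ≡ 0ℚ
  zero-off e oe with e FinP.≟ e₀
  ... | yes _ = case oe of λ ()
  ... | no _  = refl

-- Rational grids and well-founded descent on them.

fromℤ : ℤ → ℚ
fromℤ i = mkℚ i 0 (Coprime.sym (Coprime.1-coprimeTo _))

fromℤ-+ : ∀ i j → fromℤ i + fromℤ j ≡ fromℤ (i ℤ.+ j)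
fromℤ-+ i j = toℚᵘ-injective (ℚᵘP.≃-trans (toℚᵘ-homo-+ (fromℤ i) (fromℤ j))
  (ℚᵘ.*≡* (cong (ℤ._* (ℤ.+ 1)) (cong₂ ℤ._+_ (ℤP.*-identityʳ i) (ℤP.*-identityʳ j)))))

fromℤ-* : ∀ i j → fromℤ i * fromℤ j ≡ fromℤ (i ℤ.* j)
fromℤ-* i j = toℚᵘ-injective (ℚᵘP.≃-trans (toℚᵘ-homo-* (fromℤ i) (fromℤ j)) ℚᵘP.≃-refl)

fromℤ-neg : ∀ i → - fromℤ i ≡ fromℤ (ℤ.- i)
fromℤ-neg i = toℚᵘ-injective (ℚᵘP.≃-trans (toℚᵘ-homo‿- (fromℤ i)) ℚᵘP.≃-refl)

fromℤ-mono-≤ : ∀ {i j} → i ℤ.≤ j → fromℤ i ≤ fromℤ j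
fromℤ-mono-≤ i≤j = *≤* (ℤP.*-monoʳ-≤-nonNeg (ℤ.+ 1) i≤j)

fromℤ-mono-< : ∀ {i j} → i ℤ.< j → fromℤ i < fromℤ j
fromℤ-mono-< i<j = *<* (ℤP.*-monoʳ-<-pos (ℤ.+ 1) i<j)

fromℤ-cancel-< : ∀ {i j} → fromℤ i < fromℤ j → i ℤ.< j
fromℤ-cancel-< (*<* i<j) = ℤP.*-cancelʳ-<-nonNeg (ℤ.+ 1) i<j

fromℤ-cancel-≤ : ∀ {i j} → fromℤ i ≤ fromℤ j → i ℤ.≤ j
fromℤ-cancel-≤ (*≤* i≤j) = ℤP.*-cancelʳ-≤-pos _ _ (ℤ.+ 1) i≤j

-- The grid (1 / suc s) ℤ; the shift keeps the scale positive.
record OnGrid (s : ℕ) (p : ℚ) : Set where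
  constructor onGrid
  field
    multiple : ℤ
    scaled   : p * fromℤ (ℤ.+ suc s) ≡ fromℤ multiple

open OnGrid

module _ {s : ℕ} where

  private
    S : ℚ
    S = fromℤ (ℤ.+ suc s)

  grid-0 : OnGrid s 0ℚ
  grid-0 = onGrid (ℤ.+ 0) (*-zeroˡ S)

  grid-+ : ∀ {p q} → OnGrid s p → OnGrid s q → OnGrid s (p + q)
  grid-+ {p} {q} (onGrid i pi) (onGrid j qj) = onGrid (i ℤ.+ j)
    (trans (*-distribʳ-+ S p q) (trans (cong₂ _+_ pi qj) (fromℤ-+ i j)))

  grid-neg : ∀ {p} → OnGrid s p → OnGrid s (- p)
  grid-neg {p} (onGrid i pi) = onGrid (ℤ.- i)
    (trans (sym (neg-distribˡ-* p S)) (trans (cong -_ pi) (fromℤ-neg i)))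

  grid-- : ∀ {p q} → OnGrid s p → OnGrid s q → OnGrid s (p - q)
  grid-- gp gq = grid-+ gp (grid-neg gq)

  grid-⊓ : ∀ {p q} → OnGrid s p → OnGrid s q → OnGrid s (p ⊓ q)
  grid-⊓ {p} {q} gp gq with ⊓-sel p q
  ... | inj₁ eq = subst (OnGrid s) (sym eq) gp
  ... | inj₂ eq = subst (OnGrid s) (sym eq) gq

  grid-⊔ : ∀ {p q} → OnGrid s p → OnGrid s q → OnGrid s (p ⊔ q)
  grid-⊔ {p} {q} gp gq with ⊔-sel p q
  ... | inj₁ eq = subst (OnGrid s) (sym eq) gp
  ... | inj₂ eq = subst (OnGrid s) (sym eq) gq

  grid-*ℤ : ∀ {p} j → OnGrid s p → OnGrid s (p * fromℤ j)
  grid-*ℤ {p} j (onGrid i pi) = onGrid (i ℤ.* j)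
    (trans (solve 3 (λ p j S → (p :* j) :* S := (p :* S) :* j) refl p (fromℤ j) S)
      (trans (cong (_* fromℤ j) pi) (fromℤ-* i j)))

  grid-sumIf : (p : Fin n → Bool) {f : Fin n → ℚ} → (∀ e → OnGrid s (f e)) → OnGrid s (sumIf p f)
  grid-sumIf {zero}  p g = grid-0
  grid-sumIf {suc n} p {f} g = grid-+ head (grid-sumIf (p ∘ suc) (g ∘ suc))
    where
    head : OnGrid s (if p zero then f zero else 0ℚ)
    head with p zero
    ... | true  = g zero
    ... | false = grid-0

  infix 4 _≺_
  -- Plain `<` on ℚ is not well-founded, even above zero. The lower bound and the common grid are
  -- built into the relation, so that a descent becomes a descent of nonnegative integers.
  _≺_ : ℚ → ℚ → Set
  p ≺ q = 0ℚ ≤ p × OnGrid s p × OnGrid s q × p < q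

  private
    instance
      S-pos : Positive S
      S-pos = positive (fromℤ-mono-< (+<+ (s≤s z≤n)))

    numerator-mono-< : ∀ {p q} (gp : OnGrid s p) (gq : OnGrid s q) → p < q → multiple gp ℤ.< multiple gq
    numerator-mono-< (onGrid i pi) (onGrid j qj) p<q = fromℤ-cancel-< (subst₂ _<_ pi qj (*-monoˡ-<-pos S p<q))

    numerator-≥0 : ∀ {p} (gp : OnGrid s p) → 0ℚ ≤ p → ℤ.+ 0 ℤ.≤ multiple gp
    numerator-≥0 (onGrid i pi) 0≤p = fromℤ-cancel-≤
      (subst₂ _≤_ (*-zeroˡ S) pi (*-monoʳ-≤-nonNeg S {{pos⇒nonNeg S}} 0≤p))

    <-suc⇒≤ : ∀ {i m} → i ℤ.< ℤ.+ suc m → i ℤ.≤ ℤ.+ m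
    <-suc⇒≤ (+<+ (s≤s i≤m)) = +≤+ i≤m
    <-suc⇒≤ -<+             = -≤+

    -- Induction on a bound `m` for the numerator: each predecessor has a strictly smaller
    -- numerator. At bound zero a predecessor would have a negative one, against `0≤p′`.
    acc-below : ∀ m {p} (gp : OnGrid s p) → multiple gp ℤ.≤ ℤ.+ m → Acc _≺_ p
    acc-below zero    gp i≤0 = acc λ { (0≤p′ , gp′ , _ , p′<p) → contradiction
      (ℤP.<-≤-trans (numerator-mono-< gp′ gp p′<p) i≤0) (ℤP.≤⇒≯ (numerator-≥0 gp′ 0≤p′)) }
    acc-below (suc m) gp i≤m = acc λ { (_ , gp′ , _ , p′<p) → acc-below m gp′
      (<-suc⇒≤ (ℤP.<-≤-trans (numerator-mono-< gp′ gp p′<p) i≤m)) }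

  ≺-wellFounded : WellFounded _≺_
  -- The bound is read off the first predecessor `p`: its grid witness comes with `p ≺ q`, whereas
  -- `q` on its own carries none.
  ≺-wellFounded q = acc λ { (0≤p , gp , _) →
    acc-below ℤ.∣ multiple gp ∣ gp (ℤP.≤-reflexive (sym (ℤP.0≤i⇒+∣i∣≡i (numerator-≥0 gp 0≤p)))) }

-- The scale `d + s * suc d` is the one whose successor computes to `suc s * suc d`, the old
-- denominator times the new factor.
grid-refine : ∀ {s} d {p} → OnGrid s p → OnGrid (d ℕ.+ s ℕ.* suc d) p
grid-refine {s} d {p} (onGrid i pi) = onGrid (i ℤ.* D) (begin
  p * fromℤ (S ℤ.* D)          ≡⟨ cong (p *_) (sym (fromℤ-* S D)) ⟩
  p * (fromℤ S * fromℤ D)      ≡⟨ sym (*-assoc p (fromℤ S) (fromℤ D)) ⟩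
  (p * fromℤ S) * fromℤ D      ≡⟨ cong (_* fromℤ D) pi ⟩
  fromℤ i * fromℤ D            ≡⟨ fromℤ-* i D ⟩
  fromℤ (i ℤ.* D)              ∎)
  where
  open ≡-Reasoning
  S = ℤ.+ suc s
  D = ℤ.+ suc d

-- Multiplying `p` by its denominator leaves its numerator; the extra factor `suc s` makes room for
-- a grid already in use.
grid-denominator : ∀ s p → OnGrid (ℚ.denominator-1 p ℕ.+ s ℕ.* suc (ℚ.denominator-1 p)) p
grid-denominator s p@(mkℚ i d _) = onGrid (S ℤ.* i) (begin
  p * fromℤ (S ℤ.* D)          ≡⟨ cong (p *_) (sym (fromℤ-* S D)) ⟩
  p * (fromℤ S * fromℤ D)      ≡⟨ solve 3 (λ p S D → p :* (S :* D) := S :* (p :* D)) refl p (fromℤ S) (fromℤ D) ⟩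
  fromℤ S * (p * fromℤ D)
    ≡⟨ cong (fromℤ S *_) (toℚᵘ-injective {p * fromℤ D} {fromℤ i} (ℚᵘP.≃-trans (toℚᵘ-homo-* p (fromℤ D)) clear)) ⟩
  fromℤ S * fromℤ i            ≡⟨ fromℤ-* S i ⟩
  fromℤ (S ℤ.* i)              ∎)
  where
  open ≡-Reasoning
  S = ℤ.+ suc s
  D = ℤ.+ suc d
  clear : toℚᵘ p ℚᵘ.* toℚᵘ (fromℤ D) ℚᵘ.≃ toℚᵘ (fromℤ i)
  clear = ℚᵘ.*≡* (trans (ℤP.*-identityʳ (i ℤ.* D))
    (cong (i ℤ.*_) (cong (ℤ.+_) (sym (ℕP.*-identityʳ (suc d))))))

-- The middle component carries memberships on the old grid over to the refined one, so that several
-- families of data can be put on one grid in turn.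
common-grid : (f : Fin n → ℚ) (s : ℕ) →
  Σ ℕ λ s′ → (∀ {p} → OnGrid s p → OnGrid s′ p) × (∀ e → OnGrid s′ (f e))
common-grid {zero}  f s = s , (λ gp → gp) , λ ()
common-grid {suc n} f s with common-grid (f ∘ suc) s
... | s′ , keep , on-tail =
  d ℕ.+ s′ ℕ.* suc d , (λ gp → grid-refine d (keep gp)) , on-all
  where
  d = ℚ.denominator-1 (f zero)
  on-all : ∀ e → OnGrid (d ℕ.+ s′ ℕ.* suc d) (f e)
  on-all zero    = grid-denominator s′ (f zero)
  on-all (suc e) = grid-refine d (on-tail e)

-- Strict sums, minimisers and rank bounds.

sumIf-mono-< : (p : Fin n → Bool) {f g : Fin n → ℚ} → (∀ e → f e ≤ g e) →
  ∀ e₀ → p e₀ ≡ true → f e₀ < g e₀ → sumIf p f < sumIf p g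
-- The gap at `e₀` is added to `f` as a point mass: the result still lies below `g` edgewise, and
-- its sum exceeds that of `f` by the gap.
sumIf-mono-< p {f} {g} f≤g e₀ pe f<g = <-≤-trans
  (<-by-difference gap (trans (sumIf-+ p f (point e₀ gap)) (cong (sumIf p f +_) (sumIf-point p e₀ gap pe)))
    (p<q⇒0<q-p f<g))
  (sumIf-mono-≤ p (λ e _ → bound e))
  where
  gap = g e₀ - f e₀
  bound : ∀ e → f e + point e₀ gap e ≤ g e
  bound e with e FinP.≟ e₀
  ... | yes refl = ≤-reflexive (solve 2 (λ a b → a :+ (b :- a) := b) refl (f e) (g e))
  ... | no _     = ≤-trans (≤-reflexive (+-identityʳ (f e))) (f≤g e)

everywhere : Fin n → Bool
everywhere _ = true

sumIf-restrict : (p : Fin n → Bool) (f : Fin n → ℚ) →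
  sumIf everywhere (λ e → if p e then f e else 0ℚ) ≡ sumIf p f
sumIf-restrict {zero}  p f = refl
sumIf-restrict {suc n} p f = cong ((if p zero then f zero else 0ℚ) +_) (sumIf-restrict (p ∘ suc) (f ∘ suc))

0≤∧≮0⇒≡0 : ∀ {p} → 0ℚ ≤ p → ¬ (0ℚ < p) → p ≡ 0ℚ
0≤∧≮0⇒≡0 0≤p ≮ = ≤-antisym (≮⇒≥ ≮) 0≤p

minimiser : {P : Fin n → Set} → (∀ e → Dec (P e)) → (key : Fin n → ℕ) → ∀ e → P e →
  Σ (Fin n) λ e₀ → P e₀ × (∀ f → P f → key e₀ ℕ.≤ key f)
minimiser {n} {P} P? key e pe = search (key e) e pe ℕP.≤-refl
  where
  -- `k` bounds the key of the current candidate and drops with every improvement.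
  search : ∀ k e → P e → key e ℕ.≤ k → Σ (Fin n) λ e₀ → P e₀ × (∀ f → P f → key e₀ ℕ.≤ key f)
  search k e pe ke≤k with FinP.any? (λ f → P? f ×-dec (key f ℕP.<? key e))
  ... | no none = e , pe , λ f pf → ℕP.≮⇒≥ (λ kf<ke → none (f , pf , kf<ke))
  search zero e pe ke≤k | yes (f , pf , kf<ke) = contradiction (ℕP.<-≤-trans kf<ke ke≤k) λ ()
  search (suc k) e pe ke≤k | yes (f , pf , kf<ke) = search k f pf (ℕP.≤-pred (ℕP.≤-trans kf<ke ke≤k))

if-true : ∀ {b} {p q : ℚ} → b ≡ true → (if b then p else q) ≡ p
if-true refl = refl

if-false : ∀ {b} {p q : ℚ} → b ≡ false → (if b then p else q) ≡ q
if-false refl = refl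

grid-if : ∀ {s p q} (b : Bool) → OnGrid s p → OnGrid s q → OnGrid s (if b then p else q)
grid-if true  gp gq = gp
grid-if false gp gq = gq

≤⇒<∨≡ : ∀ {p q} → p ≤ q → p < q ⊎ p ≡ q
≤⇒<∨≡ {p} {q} p≤q with p <? q
... | yes p<q = inj₁ p<q
... | no p≮q  = inj₂ (≤-antisym p≤q (≮⇒≥ p≮q))

rank-bound : (r : Fin n → ℕ) → Σ ℕ λ K → ∀ e → r e ℕ.< K
rank-bound {zero}  r = 0 , λ ()
rank-bound {suc n} r with rank-bound (r ∘ suc)
... | K , r<K = suc (r zero) ℕ.⊔ K ,
  λ { zero → ℕP.m≤m⊔n (suc (r zero)) K ; (suc e) → ℕP.≤-trans (r<K e) (ℕP.m≤n⊔m (suc (r zero)) K) }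

-- One side of the market: tails of a ranking and greedy cuts.

module Side {n k : ℕ} (own : Fin n → Fin k) (rank : Fin n → ℕ) where

  at : Fin k → Fin n → Bool
  at v e = ⌊ own e FinP.≟ v ⌋

  -- Since `m <? n` is `suc m ≤? n`, the filter `from v (suc (rank e))` is by computation the one
  -- that selects the edges dominated by `e` in `bestResponseUpdate`.
  from : Fin k → ℕ → Fin n → Bool
  from v t e = ⌊ own e FinP.≟ v ⌋ ∧ ⌊ t ℕP.≤? rank e ⌋

  at-intro : ∀ {v e} → own e ≡ v → at v e ≡ true
  at-intro {v} {e} = isYes-true (own e FinP.≟ v)

  at-elim : ∀ {v e} → at v e ≡ true → own e ≡ v
  at-elim {v} {e} = isYes-witness (own e FinP.≟ v)

  from-intro : ∀ {v t e} → own e ≡ v → t ℕ.≤ rank e → from v t e ≡ true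
  from-intro {v} {t} {e} o t≤r = ∧-true (at-intro o) (isYes-true (t ℕP.≤? rank e) t≤r)

  from-elim : ∀ {v t e} → from v t e ≡ true → own e ≡ v × t ℕ.≤ rank e
  from-elim {v} {t} {e} eq = at-elim (∧-trueˡ _ eq) , isYes-witness (t ℕP.≤? rank e) (∧-trueʳ (at v e) eq)

  load : (Fin n → ℚ) → Fin k → ℚ
  load x v = sumIf (at v) x

  tail : (Fin n → ℚ) → Fin k → ℕ → ℚ
  tail x v t = sumIf (from v t) x

  -- What `e` loses when `R` is removed from the worst end: the part of `R` that the edges worse
  -- than `e` cannot supply, and at most `x e`. This is the formula of `bestResponseUpdate`.
  cut : (Fin n → ℚ) → Fin k → ℚ → Fin n → ℚ
  cut x v R e = x e ⊓ (0ℚ ⊔ (R - tail x v (suc (rank e))))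

  module _ (x : Fin n → ℚ) (0≤x : ∀ e → 0ℚ ≤ x e) where

    tail-≥0 : ∀ v t → 0ℚ ≤ tail x v t
    tail-≥0 v t = sumIf-nonneg (from v t) 0≤x

    tail-antimono : ∀ v {s t} → s ℕ.≤ t → tail x v t ≤ tail x v s
    tail-antimono v s≤t = sumIf-mono-⊆ (from v _) (from v _) 0≤x
      λ e eq → let (o , t≤r) = from-elim eq in from-intro o (ℕP.≤-trans s≤t t≤r)

    tail-≤-load : ∀ v t → tail x v t ≤ load x v
    tail-≤-load v t = sumIf-mono-⊆ (from v t) (at v) 0≤x λ e eq → at-intro (proj₁ (from-elim eq))

    tail-zero : ∀ v t → (∀ e → own e ≡ v → t ℕ.≤ rank e → x e ≡ 0ℚ) → tail x v t ≡ 0ℚ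
    tail-zero v t zeros = sumIf-0 (from v t) λ e eq → let (o , t≤r) = from-elim eq in zeros e o t≤r

    cut-≥0 : ∀ v R e → 0ℚ ≤ cut x v R e
    cut-≥0 v R e = ⊓-glb (0≤x e) (p≤p⊔q 0ℚ (R - tail x v (suc (rank e))))

    cut-≤ : ∀ v R e → cut x v R e ≤ x e
    cut-≤ v R e = p⊓q≤p (x e) _

    cut-zero : ∀ v R e → R ≤ tail x v (suc (rank e)) → cut x v R e ≡ 0ℚ
    cut-zero v R e R≤ = trans (cong (x e ⊓_) (p≥q⇒p⊔q≡p R-t≤0)) (p≥q⇒p⊓q≡q (0≤x e))
      where
      t = tail x v (suc (rank e))
      R-t≤0 : R - t ≤ 0ℚ
      R-t≤0 = ≤-by-difference (t - R) (solve 2 (λ r s → con 0ℚ := (r :- s) :+ (s :- r)) refl R t) (p≤q⇒0≤q-p R≤)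

    cut-positive⇒ : ∀ v R e → 0ℚ < cut x v R e → tail x v (suc (rank e)) < R
    cut-positive⇒ v R e 0<cut with R ≤? tail x v (suc (rank e))
    ... | yes R≤ = contradiction 0<cut (<-irrefl (sym (cut-zero v R e R≤)))
    ... | no R≰  = ≰⇒> R≰

    cut-positive : ∀ v R e → 0ℚ < x e → tail x v (suc (rank e)) < R → 0ℚ < cut x v R e
    cut-positive v R e 0<x t<R = ⊓-glb-< 0<x (<-≤-trans (p<q⇒0<q-p t<R) (p≤q⊔p 0ℚ _))

  module _ (strict : ∀ e e′ → own e ≡ own e′ → rank e ≡ rank e′ → e ≡ e′) where

    -- By strictness `e` is the only edge at `v` of its rank, so raising the threshold by one drops
    -- `e` alone.
    tail-suc : ∀ (f : Fin n → ℚ) {v} e → own e ≡ v → tail f v (rank e) ≡ f e + tail f v (suc (rank e))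
    tail-suc f {v} e o = sumIf-insert (from v (rank e)) (from v (suc (rank e))) f e
      (from-intro o ℕP.≤-refl) not-later same
      where
      not-later : from v (suc (rank e)) e ≡ false
      not-later with from v (suc (rank e)) e in eq
      ... | false = refl
      ... | true  = contradiction (proj₂ (from-elim {v} {suc (rank e)} {e} eq)) ℕP.1+n≰n
      same : ∀ f → f ≢ e → from v (rank e) f ≡ from v (suc (rank e)) f
      same f f≢e = true⇔⇒≡ _ _
        (λ eq → let (of , r≤) = from-elim eq in from-intro of
          (ℕP.≤∧≢⇒< r≤ (λ r≡ → f≢e (strict f e (trans of (sym o)) (sym r≡)))))
        (λ eq → let (of , r<) = from-elim eq in from-intro of (ℕP.<⇒≤ r<))

    tail-skip : ∀ (f : Fin n → ℚ) v t → (∀ e → ¬ (own e ≡ v × rank e ≡ t)) → tail f v t ≡ tail f v (suc t)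
    tail-skip f v t none = sumIf-congₚ (from v t) (from v (suc t)) λ e → true⇔⇒≡ _ _
      (λ eq → let (o , t≤r) = from-elim eq in from-intro o (ℕP.≤∧≢⇒< t≤r (λ t≡r → none e (o , sym t≡r))))
      (λ eq → let (o , t<r) = from-elim eq in from-intro o (ℕP.<⇒≤ t<r))

    module _ (x : Fin n → ℚ) (0≤x : ∀ e → 0ℚ ≤ x e) where

      -- Induction from the worst ranks upwards in preference. A rank held by an edge at `v` is
      -- handled by `greedy-step`; a rank held by none leaves both tails unchanged.
      cut-tail : ∀ v {R} → 0ℚ ≤ R → ∀ t → tail (cut x v R) v t ≡ R ⊓ tail x v t
      cut-tail v {R} 0≤R t = go K t (ℕP.m≤n+m K t)
        where
        K = proj₁ (rank-bound rank)
        -- `K` exceeds every rank and `d` bounds the distance from `t` up to it; at distance zero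
        -- both tails are empty.
        go : ∀ d t → K ℕ.≤ t ℕ.+ d → tail (cut x v R) v t ≡ R ⊓ tail x v t
        go zero t K≤ = trans (empty (cut x v R) (cut-≥0 x 0≤x v R))
          (trans (sym (p≥q⇒p⊓q≡q 0≤R)) (cong (R ⊓_) (sym (empty x 0≤x))))
          where
          empty : ∀ f → (∀ e → 0ℚ ≤ f e) → tail f v t ≡ 0ℚ
          empty f 0≤f = tail-zero f 0≤f v t λ e _ t≤r → contradiction
            (ℕP.≤-trans (ℕP.≤-trans K≤ (ℕP.≤-reflexive (ℕP.+-identityʳ t))) t≤r)
            (ℕP.<⇒≱ (proj₂ (rank-bound rank) e))
        go (suc d) t K≤ with FinP.any? (λ e → (own e FinP.≟ v) ×-dec (rank e ℕP.≟ t))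
        ... | yes (e , o , refl) = begin
          tail (cut x v R) v (rank e)                          ≡⟨ tail-suc (cut x v R) e o ⟩
          cut x v R e + tail (cut x v R) v (suc (rank e))
            ≡⟨ cong (cut x v R e +_) (go d (suc (rank e)) (ℕP.≤-trans K≤ (ℕP.≤-reflexive (ℕP.+-suc (rank e) d)))) ⟩
          cut x v R e + (R ⊓ tail x v (suc (rank e)))
            ≡⟨ greedy-step R (tail x v (suc (rank e))) (x e) (0≤x e) ⟩
          R ⊓ (x e + tail x v (suc (rank e)))                  ≡⟨ cong (R ⊓_) (sym (tail-suc x e o)) ⟩
          R ⊓ tail x v (rank e)                                ∎
          where open ≡-Reasoning
        ... | no none = begin
          tail (cut x v R) v t         ≡⟨ tail-skip (cut x v R) v t (λ e p → none (e , p)) ⟩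
          tail (cut x v R) v (suc t)   ≡⟨ go d (suc t) (ℕP.≤-trans K≤ (ℕP.≤-reflexive (ℕP.+-suc t d))) ⟩
          R ⊓ tail x v (suc t)         ≡⟨ cong (R ⊓_) (sym (tail-skip x v t (λ e p → none (e , p)))) ⟩
          R ⊓ tail x v t               ∎
          where open ≡-Reasoning

      load≡tail : ∀ (f : Fin n → ℚ) v → load f v ≡ tail f v 0
      load≡tail f v = sumIf-congₚ (at v) (from v 0) λ e → true⇔⇒≡ _ _
        (λ eq → from-intro (at-elim eq) z≤n) (λ eq → at-intro (proj₁ (from-elim {v} {0} {e} eq)))

      cut-load : ∀ v {R} → 0ℚ ≤ R → R ≤ load x v → load (cut x v R) v ≡ R
      cut-load v {R} 0≤R R≤ = begin
        load (cut x v R) v    ≡⟨ load≡tail (cut x v R) v ⟩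
        tail (cut x v R) v 0  ≡⟨ cut-tail v 0≤R 0 ⟩
        R ⊓ tail x v 0        ≡⟨ cong (R ⊓_) (sym (load≡tail x v)) ⟩
        R ⊓ load x v          ≡⟨ p≤q⇒p⊓q≡p R≤ ⟩
        R                     ∎
        where open ≡-Reasoning

      -- Greediness: if anything is taken from `e`, then the tail after `e`, which contains `f` and
      -- everything worse than `f`, is less than `R`, so `R` demands all of `x f`.
      cut-full : ∀ {v R} e f → own f ≡ v → rank e ℕ.< rank f →
        0ℚ < cut x v R e → cut x v R f ≡ x f
      cut-full {v} {R} e f of e<f 0<cut = p≤q⇒p⊓q≡p (≤-trans xf≤ (p≤q⊔p 0ℚ _))
        where
        tf = tail x v (suc (rank f))
        xf+tf≤R : x f + tf ≤ R
        xf+tf≤R = ≤-trans (≤-reflexive (sym (tail-suc x f of)))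
          (≤-trans (tail-antimono x 0≤x v e<f) (<⇒≤ (cut-positive⇒ x 0≤x v R e 0<cut)))
        xf≤ : x f ≤ R - tf
        xf≤ = ≤-by-difference (R - (x f + tf))
          (solve 3 (λ a t r → r :- t := a :+ (r :- (a :+ t))) refl (x f) tf R) (p≤q⇒0≤q-p xf+tf≤R)

-- The effect on one endpoint v of e₀ of raising e₀ by A and cutting the worse edges at v.
module Raise {n k : ℕ} (own : Fin n → Fin k) (rank : Fin n → ℕ)
  (strict : ∀ e e′ → own e ≡ own e′ → rank e ≡ rank e′ → e ≡ e′)
  (x : Fin n → ℚ) (0≤x : ∀ e → 0ℚ ≤ x e) (e₀ : Fin n) (quota A : ℚ)
  (load≤quota : Side.load own rank x (own e₀) ≤ quota) where

  open Side own rank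

  v : Fin k
  v = own e₀

  free dom R : ℚ
  free = quota - load x v
  dom  = tail x v (suc (rank e₀))
  R    = 0ℚ ⊔ (A - free)

  loss : Fin n → ℚ
  loss = cut x v R

  R-≥0 : 0ℚ ≤ R
  R-≥0 = p≤p⊔q 0ℚ (A - free)

  Worse : Fin n → Set
  Worse e = Σ (Fin n) λ e′ → own e′ ≡ own e × 0ℚ < x e′ × rank e ℕ.< rank e′

  -- One of the three bounds that make the amount of a blocking edge positive: either there is free
  -- quota, or the worse positive edge lies in the dominated tail.
  room : load x v < quota ⊎ Worse e₀ → 0ℚ < free + dom
  room (inj₁ l<q) = +-mono-<-≤ (p<q⇒0<q-p l<q) (tail-≥0 x 0≤x v (suc (rank e₀)))
  room (inj₂ (e′ , o , 0<x , r<)) = +-mono-≤-< (p≤q⇒0≤q-p load≤quota)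
    (<-≤-trans 0<x (≤-trans
      (≤-by-difference (tail x v (suc (rank e′))) (tail-suc strict x e′ o) (tail-≥0 x 0≤x v (suc (rank e′))))
      (tail-antimono x 0≤x v r<)))

  module _ (0≤A : 0ℚ ≤ A) (A≤ : A ≤ free + dom) where

    R-≤A : R ≤ A
    R-≤A = ⊔-lub {A} {0ℚ} {A - free} 0≤A
      (≤-by-difference free (solve 2 (λ a f → a := (a :- f) :+ f) refl A free) (p≤q⇒0≤q-p load≤quota))

    R-≤dom : R ≤ dom
    R-≤dom = ⊔-lub {dom} {0ℚ} {A - free} (tail-≥0 x 0≤x v (suc (rank e₀)))
      (≤-by-difference ((free + dom) - A)
        (solve 3 (λ a f d → d := (a :- f) :+ ((f :+ d) :- a)) refl A free dom) (p≤q⇒0≤q-p A≤))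

    -- The edges dominated by `e₀` hold at least `R`, so the cut is used up before it reaches `e₀`
    -- or anything better.
    loss-better : ∀ e → rank e ℕ.≤ rank e₀ → loss e ≡ 0ℚ
    loss-better e r≤ = cut-zero x 0≤x v R e (≤-trans R-≤dom (tail-antimono x 0≤x v (s≤s r≤)))

    load-loss : load loss v ≡ R
    load-loss = cut-load strict x 0≤x v R-≥0 (≤-trans R-≤dom (tail-≤-load x 0≤x v (suc (rank e₀))))

    module _ (y : Fin n → ℚ) (balance : ∀ e → own e ≡ v → y e + loss e ≡ x e + point e₀ A e) where

      -- Summing `balance` over the edges at `v` turns the cuts into `R` and the raise into `A`; the
      -- facts about the new load are read off this identity.
      load-balance : load y v + R ≡ load x v + A
      load-balance = begin
        load y v + R                     ≡⟨ cong (load y v +_) (sym load-loss) ⟩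
        load y v + load loss v           ≡⟨ sym (sumIf-+ (at v) y loss) ⟩
        load (λ e → y e + loss e) v      ≡⟨ sumIf-cong (at v) (λ e o → balance e (at-elim o)) ⟩
        load (λ e → x e + point e₀ A e) v ≡⟨ sumIf-+ (at v) x (point e₀ A) ⟩
        load x v + load (point e₀ A) v   ≡⟨ cong (load x v +_) (sumIf-point (at v) e₀ A (at-intro refl)) ⟩
        load x v + A                     ∎
        where open ≡-Reasoning

      load-new : load y v ≡ (load x v + A) - R
      load-new = trans (solve 2 (λ l r → l := (l :+ r) :- r) refl (load y v) R) (cong (_- R) load-balance)

      load-grows : load x v ≤ load y v
      load-grows = ≤-by-difference (A - R)
        (trans load-new (solve 3 (λ l a r → (l :+ a) :- r := l :+ (a :- r)) refl (load x v) A R)) (p≤q⇒0≤q-p R-≤A)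

      load-new-≤ : load y v ≤ quota
      load-new-≤ = ≤-by-difference (R - (A - free))
        (trans (solve 4 (λ q l a r → q := ((l :+ a) :- r) :+ (r :- (a :- (q :- l)))) refl quota (load x v) A R)
          (cong (_+ (R - (A - free))) (sym load-new)))
        (p≤q⇒0≤q-p (p≤q⊔p 0ℚ (A - free)))

      -- A positive `R` equals `A - free`: the free quota is used up, and the cut removes exactly
      -- the excess over the quota.
      load-full : 0ℚ < R → load y v ≡ quota
      load-full 0<R with ⊔-sel 0ℚ (A - free)
      ... | inj₁ R≡0 = contradiction 0<R (<-irrefl (sym R≡0))
      ... | inj₂ R≡  = trans load-new (trans (cong (λ r → (load x v + A) - r) R≡)
        (solve 3 (λ q l a → (l :+ a) :- (a :- (q :- l)) := q) refl quota (load x v) A))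

-- A single best response step: balance, feasibility and the grid.

module Dynamics (I : Instance) (W : WellFormed I) where

  open Instance I
  open WellFormed W
  module J = Side job rankJ
  module M = Side mach rankM

  WorseJ WorseM : Allocation I → Fin nE → Set
  WorseJ x e = Σ (Fin nE) λ e′ → job e′ ≡ job e × 0ℚ < x e′ × rankJ e ℕ.< rankJ e′
  WorseM x e = Σ (Fin nE) λ e′ → mach e′ ≡ mach e × 0ℚ < x e′ × rankM e ℕ.< rankM e′

  worseJ? : ∀ x e → Dec (WorseJ x e)
  worseJ? x e = FinP.any? λ e′ → (job e′ FinP.≟ job e) ×-dec ((0ℚ <? x e′) ×-dec (rankJ e ℕP.<? rankJ e′))

  worseM? : ∀ x e → Dec (WorseM x e)
  worseM? x e = FinP.any? λ e′ → (mach e′ FinP.≟ mach e) ×-dec ((0ℚ <? x e′) ×-dec (rankM e ℕP.<? rankM e′))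

  blocks? : ∀ x e → Dec (Blocks I x e)
  blocks? x e = (x e <? cap e)
    ×-dec (((loadJ I x (job e) <? qJ (job e)) ⊎-dec worseJ? x e)
    ×-dec ((loadM I x (mach e) <? qM (mach e)) ⊎-dec worseM? x e))

  module Step (x : Allocation I) (feasible : Feasible I x) (e₀ : Fin nE) (blocking : Blocks I x e₀) where

    0≤x : ∀ e → 0ℚ ≤ x e
    0≤x = proj₁ feasible

    x≤cap : ∀ e → x e ≤ cap e
    x≤cap = proj₁ (proj₂ feasible)

    j : Fin nJ
    j = job e₀

    m : Fin nM
    m = mach e₀

    loadJ≤ : ∀ j → loadJ I x j ≤ qJ j
    loadJ≤ = proj₁ (proj₂ (proj₂ feasible))

    loadM≤ : ∀ m → loadM I x m ≤ qM m
    loadM≤ = proj₂ (proj₂ (proj₂ feasible))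

    roomJ roomM A : ℚ
    roomJ = (qJ j - loadJ I x j) + J.tail x j (suc (rankJ e₀))
    roomM = (qM m - loadM I x m) + M.tail x m (suc (rankM e₀))
    A = roomJ ⊓ ((cap e₀ - x e₀) ⊓ roomM)

    module RJ = Raise job rankJ rankJ-strict x 0≤x e₀ (qJ j) A (loadJ≤ j)
    module RM = Raise mach rankM rankM-strict x 0≤x e₀ (qM m) A (loadM≤ m)

    A-positive : 0ℚ < A
    A-positive = ⊓-glb-< (RJ.room (proj₁ (proj₂ blocking)))
      (⊓-glb-< (p<q⇒0<q-p (proj₁ blocking)) (RM.room (proj₂ (proj₂ blocking))))

    0≤A : 0ℚ ≤ A
    0≤A = <⇒≤ A-positive

    A≤roomJ : A ≤ roomJ
    A≤roomJ = p⊓q≤p roomJ _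

    A≤rest : A ≤ (cap e₀ - x e₀) ⊓ roomM
    A≤rest = p⊓q≤q roomJ _

    A≤roomM : A ≤ roomM
    A≤roomM = ≤-trans A≤rest (p⊓q≤q (cap e₀ - x e₀) roomM)

    A≤cap : A ≤ cap e₀ - x e₀
    A≤cap = ≤-trans A≤rest (p⊓q≤p (cap e₀ - x e₀) roomM)

    y : Allocation I
    y = bestResponseUpdate I x e₀

    y-raised : y e₀ ≡ x e₀ + A
    y-raised = if-true (isYes-true (e₀ FinP.≟ e₀) refl)

    y-job : ∀ {e} → e ≢ e₀ → job e ≡ j → y e ≡ x e - RJ.loss e
    y-job {e} e≢ o = trans (if-false (isYes-false (e FinP.≟ e₀) e≢)) (if-true (J.at-intro o))

    -- The update tests the job first. As the graph is simple, an edge at `m` other than `e₀`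
    -- belongs to another job, so the machine clause applies to it.
    y-mach : ∀ {e} → e ≢ e₀ → mach e ≡ m → y e ≡ x e - RM.loss e
    y-mach {e} e≢ o = trans (if-false (isYes-false (e FinP.≟ e₀) e≢))
      (trans (if-false (isYes-false (job e FinP.≟ j) (λ oj → e≢ (simple e e₀ oj o)))) (if-true (M.at-intro o)))

    y-other : ∀ {e} → job e ≢ j → mach e ≢ m → y e ≡ x e
    y-other {e} oj om = trans (if-false (isYes-false (e FinP.≟ e₀) (oj ∘ cong job)))
      (trans (if-false (isYes-false (job e FinP.≟ j) oj)) (if-false (isYes-false (mach e FinP.≟ m) om)))

    -- Covers `e₀` for both endpoints: its loss `l` is zero by `loss-better`, in accordance with the
    -- update, which never cuts `e₀`.
    balance-raised : ∀ {l} → l ≡ 0ℚ → y e₀ + l ≡ x e₀ + point e₀ A e₀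
    balance-raised refl = trans (+-identityʳ (y e₀)) (trans y-raised (cong (x e₀ +_) (sym (point-≡ e₀ A))))

    balance-cut : ∀ {e l} → e ≢ e₀ → y e ≡ x e - l → y e + l ≡ x e + point e₀ A e
    balance-cut {e} {l} e≢ eq = trans (cong (_+ l) eq)
      (trans (solve 2 (λ x l → (x :- l) :+ l := x :+ con 0ℚ) refl (x e) l)
        (cong (x e +_) (sym (point-≢ A e≢))))

    balanceJ : ∀ e → job e ≡ j → y e + RJ.loss e ≡ x e + point e₀ A e
    balanceJ e o = [ (λ { refl → balance-raised (RJ.loss-better 0≤A A≤roomJ e₀ ℕP.≤-refl) })
      , (λ e≢ → balance-cut e≢ (y-job e≢ o)) ]′ (toSum (e FinP.≟ e₀))

    balanceM : ∀ e → mach e ≡ m → y e + RM.loss e ≡ x e + point e₀ A e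
    balanceM e o = [ (λ { refl → balance-raised (RM.loss-better 0≤A A≤roomM e₀ ℕP.≤-refl) })
      , (λ e≢ → balance-cut e≢ (y-mach e≢ o)) ]′ (toSum (e FinP.≟ e₀))

    cases : ∀ (P : Fin nE → Set) → P e₀ → (∀ {e} → e ≢ e₀ → job e ≡ j → P e) →
      (∀ {e} → e ≢ e₀ → mach e ≡ m → P e) → (∀ {e} → job e ≢ j → mach e ≢ m → P e) → ∀ e → P e
    cases P p₀ pj pm po e with e FinP.≟ e₀ | job e FinP.≟ j | mach e FinP.≟ m
    ... | yes refl | _      | _      = p₀
    ... | no e≢    | yes oj | _      = pj e≢ oj
    ... | no e≢    | no _   | yes om = pm e≢ om
    ... | no _     | no oj  | no om  = po oj om

    0≤y : ∀ e → 0ℚ ≤ y e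
    0≤y = cases (λ e → 0ℚ ≤ y e)
      (subst (0ℚ ≤_) (sym y-raised) (+-mono-≤ (0≤x e₀) 0≤A))
      (λ {e} e≢ o → subst (0ℚ ≤_) (sym (y-job e≢ o)) (p≤q⇒0≤q-p (J.cut-≤ x 0≤x j RJ.R e)))
      (λ {e} e≢ o → subst (0ℚ ≤_) (sym (y-mach e≢ o)) (p≤q⇒0≤q-p (M.cut-≤ x 0≤x m RM.R e)))
      (λ {e} oj om → subst (0ℚ ≤_) (sym (y-other oj om)) (0≤x e))

    x-l≤x : ∀ x {l} → 0ℚ ≤ l → x - l ≤ x
    x-l≤x x {l} = ≤-by-difference l (solve 2 (λ x l → x := (x :- l) :+ l) refl x l)

    y≤x : ∀ e → e ≢ e₀ → y e ≤ x e
    y≤x = cases (λ e → e ≢ e₀ → y e ≤ x e)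
      (λ e≢ → contradiction refl e≢)
      (λ {e} e≢ o _ → subst (_≤ x e) (sym (y-job e≢ o)) (x-l≤x (x e) (J.cut-≥0 x 0≤x j RJ.R e)))
      (λ {e} e≢ o _ → subst (_≤ x e) (sym (y-mach e≢ o)) (x-l≤x (x e) (M.cut-≥0 x 0≤x m RM.R e)))
      (λ oj om _ → ≤-reflexive (y-other oj om))

    y≤cap : ∀ e → y e ≤ cap e
    y≤cap e = [ (λ { refl → subst (_≤ cap e₀) (sym y-raised) (≤-by-difference ((cap e₀ - x e₀) - A)
      (solve 3 (λ c x a → c := (x :+ a) :+ ((c :- x) :- a)) refl (cap e₀) (x e₀) A) (p≤q⇒0≤q-p A≤cap)) })
      , (λ e≢ → ≤-trans (y≤x e e≢) (x≤cap e)) ]′ (toSum (e FinP.≟ e₀))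

    -- No edge except `e₀` grows, which settles all vertices other than `j` and `m`; at these two
    -- the load is bounded by `load-new-≤`.
    y-feasible : Feasible I y
    y-feasible = 0≤y , y≤cap , loadJ-y , loadM-y
      where
      loadJ-y : ∀ k → loadJ I y k ≤ qJ k
      loadJ-y k with k FinP.≟ j
      ... | yes refl = RJ.load-new-≤ 0≤A A≤roomJ y balanceJ
      ... | no k≢    = ≤-trans (sumIf-mono-≤ (J.at k) (λ e o → y≤x e (λ { refl → k≢ (sym (J.at-elim o)) }))) (loadJ≤ k)
      loadM-y : ∀ k → loadM I y k ≤ qM k
      loadM-y k with k FinP.≟ m
      ... | yes refl = RM.load-new-≤ 0≤A A≤roomM y balanceM
      ... | no k≢    = ≤-trans (sumIf-mono-≤ (M.at k) (λ e o → y≤x e (λ { refl → k≢ (sym (M.at-elim o)) }))) (loadM≤ k)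

    module _ {s : ℕ} (x-grid : ∀ e → OnGrid s (x e)) (cap-grid : ∀ e → OnGrid s (cap e))
      (qJ-grid : ∀ j → OnGrid s (qJ j)) (qM-grid : ∀ m → OnGrid s (qM m)) where

      private
        freeJ-grid : OnGrid s (qJ j - loadJ I x j)
        freeJ-grid = grid-- (qJ-grid j) (grid-sumIf (J.at j) x-grid)
        freeM-grid : OnGrid s (qM m - loadM I x m)
        freeM-grid = grid-- (qM-grid m) (grid-sumIf (M.at m) x-grid)
        A-grid : OnGrid s A
        A-grid = grid-⊓ (grid-+ freeJ-grid (grid-sumIf (J.from j (suc (rankJ e₀))) x-grid))
          (grid-⊓ (grid-- (cap-grid e₀) (x-grid e₀))
            (grid-+ freeM-grid (grid-sumIf (M.from m (suc (rankM e₀))) x-grid)))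

      y-grid : ∀ e → OnGrid s (y e)
      y-grid e = grid-if ⌊ e FinP.≟ e₀ ⌋ (grid-+ (x-grid e) A-grid)
        (grid-if ⌊ job e FinP.≟ j ⌋ (grid-- (x-grid e) (grid-⊓ (x-grid e) (grid-⊔ grid-0
            (grid-- (grid-⊔ grid-0 (grid-- A-grid freeJ-grid)) (grid-sumIf (J.from j (suc (rankJ e))) x-grid)))))
        (grid-if ⌊ mach e FinP.≟ m ⌋ (grid-- (x-grid e) (grid-⊓ (x-grid e) (grid-⊔ grid-0
            (grid-- (grid-⊔ grid-0 (grid-- A-grid freeM-grid)) (grid-sumIf (M.from m (suc (rankM e))) x-grid)))))
        (x-grid e)))

    RJ≡0⇒loss≡0 : RJ.R ≡ 0ℚ → ∀ e → RJ.loss e ≡ 0ℚ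
    RJ≡0⇒loss≡0 R≡0 e = J.cut-zero x 0≤x j RJ.R e
      (subst (_≤ J.tail x j (suc (rankJ e))) (sym R≡0) (J.tail-≥0 x 0≤x j (suc (rankJ e))))

    -- With `R` zero at `j` the greedy cut there takes nothing, so the effects of the step are
    -- confined to one machine.
    y-away : RJ.R ≡ 0ℚ → ∀ e → e ≢ e₀ → mach e ≢ m → y e ≡ x e
    y-away R≡0 = cases (λ e → e ≢ e₀ → mach e ≢ m → y e ≡ x e)
      (λ e≢ _ → contradiction refl e≢)
      (λ {e} e≢ o _ _ → trans (y-job e≢ o)
        (trans (cong (λ l → x e - l) (RJ≡0⇒loss≡0 R≡0 e)) (+-identityʳ (x e))))
      (λ _ om _ om≢ → contradiction om om≢)
      (λ oj om _ _ → y-other oj om)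

    -- Only `e₀` can grow in a step, so any other edge positive in `y` was positive in `x`.
    worse-shrinks : ∀ {e f} → job f ≡ job e → 0ℚ < y f → rankJ e ℕ.< rankJ f → f ≢ e₀ → WorseJ x e
    worse-shrinks {e} {f} o 0<yf r< f≢ = f , o , <-≤-trans 0<yf (y≤x f f≢) , r<

  -- The job potential and the welfare of the machines.

  u : Allocation I → Fin nE → ℚ
  u x e = if ⌊ worseJ? x e ⌋ then cap e else x e

  jobPotential : Allocation I → ℚ
  jobPotential x = sumIf everywhere (u x)

  maxRank : ℕ
  maxRank = proj₁ (rank-bound rankM)

  -- `maxRank` strictly exceeds every machine rank, so despite truncated subtraction the weight
  -- falls strictly from each occurring rank to the next integer.
  weightAt : ℕ → ℚ
  weightAt r = fromℤ (ℤ.+ (maxRank ℕ.∸ r))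

  weight : Fin nE → ℚ
  weight e = weightAt (rankM e)

  weightAt-≥0 : ∀ r → 0ℚ ≤ weightAt r
  weightAt-≥0 r = fromℤ-mono-≤ (ℤ.+≤+ z≤n)

  welfare : Allocation I → ℚ
  welfare x = sumIf everywhere (λ e → x e * weight e)

  -- Welfare grows, while well-foundedness asks for a nonnegative quantity that falls; the
  -- capacities bound welfare from above.
  regret : Allocation I → ℚ
  regret x = welfare cap - welfare x

  regret-≥0 : ∀ {x} → Feasible I x → 0ℚ ≤ regret x
  regret-≥0 {x} (_ , x≤cap , _) = p≤q⇒0≤q-p (sumIf-mono-≤ everywhere
    (λ e _ → *-monoʳ-≤-nonNeg (weight e) {{nonNegative (weightAt-≥0 (rankM e))}} (x≤cap e)))

  u-yes : ∀ {x e} → WorseJ x e → u x e ≡ cap e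
  u-yes {x} {e} w = if-true (isYes-true (worseJ? x e) w)

  u-no : ∀ {x e} → ¬ WorseJ x e → u x e ≡ x e
  u-no {x} {e} ¬w = if-false (isYes-false (worseJ? x e) ¬w)

  u-≥x : ∀ {x} → Feasible I x → ∀ e → x e ≤ u x e
  u-≥x {x} (_ , x≤cap , _) e = [ (λ w → ≤-trans (x≤cap e) (≤-reflexive (sym (u-yes w))))
    , (λ ¬w → ≤-reflexive (sym (u-no ¬w))) ]′ (toSum (worseJ? x e))

  u-≤cap : ∀ {x} → Feasible I x → ∀ e → u x e ≤ cap e
  u-≤cap {x} (_ , x≤cap , _) e = [ (λ w → ≤-reflexive (u-yes w))
    , (λ ¬w → ≤-trans (≤-reflexive (u-no ¬w)) (x≤cap e)) ]′ (toSum (worseJ? x e))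

  jobPotential-≥0 : ∀ {x} → Feasible I x → 0ℚ ≤ jobPotential x
  jobPotential-≥0 feasible = sumIf-nonneg everywhere (λ e → ≤-trans (proj₁ feasible e) (u-≥x feasible e))

  module _ {s : ℕ} {x : Allocation I} (x-grid : ∀ e → OnGrid s (x e)) (cap-grid : ∀ e → OnGrid s (cap e)) where

    jobPotential-grid : OnGrid s (jobPotential x)
    jobPotential-grid = grid-sumIf everywhere (λ e → grid-if ⌊ worseJ? x e ⌋ (cap-grid e) (x-grid e))

    regret-grid : OnGrid s (regret x)
    regret-grid = grid-- (grid-sumIf everywhere (λ e → grid-*ℤ (ℤ.+ (maxRank ℕ.∸ rankM e)) (cap-grid e)))
      (grid-sumIf everywhere (λ e → grid-*ℤ (ℤ.+ (maxRank ℕ.∸ rankM e)) (x-grid e)))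

  -- How one step moves the potentials.

  module _ (x : Allocation I) (feasible : Feasible I x) (e₀ : Fin nE) (blocking : Blocks I x e₀) where
    open Step x feasible e₀ blocking

    module _ (worse₀ : WorseJ x e₀) where

      -- If `e` has a worse positive edge in `x`, it counts with its capacity already. Otherwise `e`
      -- is not `e₀`, and no worse positive edge appears: were it `e₀`, the edge given by `worse₀`
      -- would be worse than `e` too. So `e` counts with `y e`, which is at most `x e`.
      u-decreases : ∀ e → u y e ≤ u x e
      u-decreases e = [ (λ w → ≤-trans (u-≤cap y-feasible e) (≤-reflexive (sym (u-yes w))))
        , no-worse ]′ (toSum (worseJ? x e))
        where
        no-worse : ¬ WorseJ x e → u y e ≤ u x e
        no-worse ¬w = ≤-trans (≤-reflexive (u-no ¬wy)) (≤-trans (y≤x e e≢) (≤-reflexive (sym (u-no ¬w))))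
          where
          e≢ : e ≢ e₀
          e≢ refl = ¬w worse₀
          ¬wy : ¬ WorseJ y e
          ¬wy (f , o , 0<yf , r<) = [ (λ { refl → ¬w (let (g , og , 0<xg , rg) = worse₀ in
              g , trans og o , 0<xg , ℕP.<-trans r< rg) })
            , (λ f≢ → ¬w (worse-shrinks o 0<yf r< f≢)) ]′ (toSum (f FinP.≟ e₀))

      jobPotential-≤ : jobPotential y ≤ jobPotential x
      jobPotential-≤ = sumIf-mono-≤ everywhere (λ e _ → u-decreases e)

      -- The worst positive edge of j is cut first, and it counts with its value x, not with cap.
      jobPotential-< : 0ℚ < RJ.R → jobPotential y < jobPotential x
      jobPotential-< 0<R with minimiser {P = λ e → job e ≡ j × 0ℚ < x e}
          -- Subtracting from a bound reverses the ranks: the minimiser of this key is the worst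
          -- positive edge of `j`.
          (λ e → (job e FinP.≟ j) ×-dec (0ℚ <? x e)) (λ e → proj₁ (rank-bound rankJ) ℕ.∸ rankJ e)
          (proj₁ worse₀) (proj₁ (proj₂ worse₀) , proj₁ (proj₂ (proj₂ worse₀)))
      ... | w , (ow , 0<xw) , extremal = sumIf-mono-< everywhere u-decreases w refl
          (<-≤-trans (subst (_< x w) (sym (u-no ¬wy)) yw<xw) (u-≥x feasible w))
        where
        last : ∀ {f} → job f ≡ j → 0ℚ < x f → ¬ (rankJ w ℕ.< rankJ f)
        last {f} of 0<xf r< = ℕP.<⇒≱ (ℕP.∸-monoʳ-< r< (ℕP.<⇒≤ (proj₂ (rank-bound rankJ) f))) (extremal f (of , 0<xf))
        w≢ : w ≢ e₀
        w≢ refl = last (proj₁ (proj₂ worse₀)) (proj₁ (proj₂ (proj₂ worse₀))) (proj₂ (proj₂ (proj₂ worse₀)))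
        ¬wy : ¬ WorseJ y w
        ¬wy (f , o , 0<yf , r<) = [ (λ { refl → last (proj₁ (proj₂ worse₀)) (proj₁ (proj₂ (proj₂ worse₀)))
              (ℕP.<-trans r< (proj₂ (proj₂ (proj₂ worse₀)))) })
          , (λ f≢ → last (trans o ow) (<-≤-trans 0<yf (y≤x f f≢)) r<) ]′ (toSum (f FinP.≟ e₀))
        no-tail : J.tail x j (suc (rankJ w)) ≡ 0ℚ
        no-tail = J.tail-zero x 0≤x j (suc (rankJ w))
          λ f of r< → 0≤∧≮0⇒≡0 (0≤x f) (λ 0<xf → last of 0<xf r<)
        0<loss : 0ℚ < RJ.loss w
        0<loss = J.cut-positive x 0≤x j RJ.R w 0<xw (subst (_< RJ.R) (sym no-tail) 0<R)
        yw<xw : y w < x w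
        yw<xw = <-by-difference (RJ.loss w)
          (trans (solve 2 (λ x l → x := (x :- l) :+ l) refl (x w) (RJ.loss w))
            (cong (_+ RJ.loss w) (sym (y-job w≢ ow)))) 0<loss

    module _ (R≡0 : RJ.R ≡ 0ℚ) where

      private
        -- The cut at `m` continued by zero, so that the balance of the step can be summed over all
        -- edges at once.
        lossM : Fin nE → ℚ
        lossM e = if M.at m e then RM.loss e else 0ℚ

      balance : ∀ e → y e + lossM e ≡ x e + point e₀ A e
      balance e = [ (λ om → trans (cong (y e +_) (if-true (M.at-intro om))) (balanceM e om))
        , (λ om → trans (cong (y e +_) (if-false (isYes-false (mach e FinP.≟ m) om)))
            (cong₂ _+_ (y-away R≡0 e (om ∘ cong mach) om) (sym (point-≢ A (om ∘ cong mach))))) ]′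
        (toSum (mach e FinP.≟ m))

      private
        -- `w₁`, the weight of the rank just after `e₀`, is an upper bound for the weight of every
        -- edge cut at `m`.
        w₀ w₁ : ℚ
        w₀ = weightAt (rankM e₀)
        w₁ = weightAt (suc (rankM e₀))

        w₁<w₀ : w₁ < w₀
        w₁<w₀ = fromℤ-mono-< (ℤ.+<+ (ℕP.∸-monoʳ-< (ℕP.n<1+n (rankM e₀)) (proj₂ (rank-bound rankM) e₀)))

      lossM-weight : ∀ e → lossM e * weight e ≤ lossM e * w₁
      lossM-weight e = [ at-m , away ]′ (toSum (mach e FinP.≟ m))
        where
        zero-case : lossM e ≡ 0ℚ → lossM e * weight e ≤ lossM e * w₁
        zero-case eq = ≤-reflexive (trans (cong (_* weight e) eq) (trans (*-zeroˡ (weight e))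
          (sym (trans (cong (_* w₁) eq) (*-zeroˡ w₁)))))
        away : mach e ≢ m → lossM e * weight e ≤ lossM e * w₁
        away om = zero-case (if-false (isYes-false (mach e FinP.≟ m) om))
        at-m : mach e ≡ m → lossM e * weight e ≤ lossM e * w₁
        at-m om = [ (λ r≤ → zero-case (trans (if-true (M.at-intro om)) (RM.loss-better 0≤A A≤roomM e r≤)))
          , (λ r≰ → *-monoˡ-≤-nonNeg (lossM e)
              {{nonNegative (subst (0ℚ ≤_) (sym (if-true (M.at-intro om))) (M.cut-≥0 x 0≤x m RM.R e))}}
              (fromℤ-mono-≤ (ℤ.+≤+ (ℕP.∸-monoʳ-≤ maxRank (ℕP.≰⇒> r≰))))) ]′ (toSum (rankM e ℕP.≤? rankM e₀))

      lossM-total : sumIf everywhere (λ e → lossM e * weight e) ≤ A * w₁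
      lossM-total = begin
        sumIf everywhere (λ e → lossM e * weight e)  ≤⟨ sumIf-mono-≤ everywhere (λ e _ → lossM-weight e) ⟩
        sumIf everywhere (λ e → lossM e * w₁)        ≡⟨ sumIf-*ʳ everywhere lossM w₁ ⟩
        sumIf everywhere lossM * w₁
          ≡⟨ cong (_* w₁) (trans (sumIf-restrict (M.at m) RM.loss) (RM.load-loss 0≤A A≤roomM)) ⟩
        RM.R * w₁
          ≤⟨ *-monoʳ-≤-nonNeg w₁ {{nonNegative (weightAt-≥0 (suc (rankM e₀)))}} (RM.R-≤A 0≤A A≤roomM) ⟩
        A * w₁                                       ∎
        where open ≤-Reasoning

      welfare-balance : welfare y + sumIf everywhere (λ e → lossM e * weight e) ≡ welfare x + A * w₀
      welfare-balance = begin
        welfare y + sumIf everywhere (λ e → lossM e * weight e)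
          ≡⟨ sym (sumIf-+ everywhere (λ e → y e * weight e) (λ e → lossM e * weight e)) ⟩
        sumIf everywhere (λ e → y e * weight e + lossM e * weight e)  ≡⟨ sumIf-cong everywhere (λ e _ → weighted e) ⟩
        sumIf everywhere (λ e → x e * weight e + point e₀ (A * w₀) e)
          ≡⟨ sumIf-+ everywhere (λ e → x e * weight e) (point e₀ (A * w₀)) ⟩
        welfare x + sumIf everywhere (point e₀ (A * w₀))
          ≡⟨ cong (welfare x +_) (sumIf-point everywhere e₀ (A * w₀) refl) ⟩
        welfare x + A * w₀                                            ∎
        where
        open ≡-Reasoning
        point-weight : ∀ e → point e₀ A e * weight e ≡ point e₀ (A * w₀) e
        point-weight e = [ (λ { refl → trans (cong (_* w₀) (point-≡ e A)) (sym (point-≡ e (A * w₀))) })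
          , (λ e≢ → trans (cong (_* weight e) (point-≢ A e≢))
              (trans (*-zeroˡ (weight e)) (sym (point-≢ (A * w₀) e≢)))) ]′
          (toSum (e FinP.≟ e₀))
        weighted : ∀ e → y e * weight e + lossM e * weight e ≡ x e * weight e + point e₀ (A * w₀) e
        weighted e = trans (sym (*-distribʳ-+ (weight e) (y e) (lossM e)))
          (trans (cong (_* weight e) (balance e))
          (trans (*-distribʳ-+ (weight e) (x e) (point e₀ A e)) (cong (x e * weight e +_) (point-weight e))))

      -- The raise contributes `A * w₀`, while the cuts cost at most `A * w₁`: they total `R`, which
      -- is at most `A`, and hit only edges worse than `e₀`. Since `A` is positive, the gain is
      -- strict.
      welfare-< : welfare x < welfare y
      welfare-< = ≰⇒> λ y≤x → <-irrefl welfare-balance (≤-<-trans (+-mono-≤ y≤x lossM-total)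
        (+-monoʳ-< (welfare x) (*-monoʳ-<-pos A {{positive A-positive}} w₁<w₀)))

      regret-< : regret y < regret x
      regret-< = +-monoʳ-< (welfare cap) (neg-antimono-< welfare-<)

  -- Settled allocations and their preservation.

  Settled : Allocation I → Set
  Settled x = ∀ e → Blocks I x e → ¬ WorseJ x e

  Best : Allocation I → Fin nE → Set
  Best x e₀ = Blocks I x e₀ × (∀ e → job e ≡ job e₀ → Blocks I x e → rankJ e₀ ℕ.≤ rankJ e)

  -- The rank comparison with the given `e` is kept because it makes any edge worse than `e` also
  -- worse than `e₀`.
  best : ∀ {x} e → Blocks I x e → Σ (Fin nE) λ e₀ → job e₀ ≡ job e × rankJ e₀ ℕ.≤ rankJ e × Best x e₀
  best {x} e b with minimiser {P = λ f → job f ≡ job e × Blocks I x f}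
    (λ f → (job f FinP.≟ job e) ×-dec blocks? x f) rankJ e (refl , b)
  ... | e₀ , (o , b₀) , least = e₀ , o , least e (refl , b) , b₀ ,
    λ f of bf → least f (trans of o , bf)

  module _ (x : Allocation I) (feasible : Feasible I x) (e₀ : Fin nE) (best₀ : Best x e₀) where

    private
      blocking = proj₁ best₀
    open Step x feasible e₀ blocking

    -- `R` is at most the total on the dominated edges, and these are all zero if `e₀` has no worse
    -- positive edge.
    ¬worse⇒R≡0 : ¬ WorseJ x e₀ → RJ.R ≡ 0ℚ
    ¬worse⇒R≡0 ¬w = ≤-antisym (≤-trans (RJ.R-≤dom 0≤A A≤roomJ) (≤-reflexive dom≡0)) RJ.R-≥0
      where
      dom≡0 : RJ.dom ≡ 0ℚ
      dom≡0 = J.tail-zero x 0≤x j (suc (rankJ e₀))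
        λ f of r< → 0≤∧≮0⇒≡0 (0≤x f) (λ 0<xf → ¬w (f , of , 0<xf , r<))

    module _ (R≡0 : RJ.R ≡ 0ℚ) where

      Accepts : Allocation I → Fin nE → Set
      Accepts z e = loadM I z (mach e) < qM (mach e) ⊎ WorseM z e

      -- After a cut m is full and holds no edge worse than the one cut.
      cut⇒refused : ∀ {e} → mach e ≡ m → 0ℚ < RM.loss e → ¬ Accepts y e
      cut⇒refused {e} om 0<loss (inj₁ l<q) = <-irrefl
        (RM.load-full 0≤A A≤roomM y balanceM
          (≤-<-trans (M.tail-≥0 x 0≤x m (suc (rankM e))) (M.cut-positive⇒ x 0≤x m RM.R e 0<loss)))
        (subst (λ k → loadM I y k < qM k) om l<q)
      cut⇒refused {e} om 0<loss (inj₂ (f , o , 0<yf , r<)) =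
        [ (λ { refl → <-irrefl (sym (RM.loss-better 0≤A A≤roomM e (ℕP.<⇒≤ r<))) 0<loss })
        , (λ f≢ → <-irrefl (sym (trans (y-mach f≢ of)
            (trans (cong (λ l → x f - l) (M.cut-full rankM-strict x 0≤x {R = RM.R} e f of r< 0<loss))
              (+-inverseʳ (x f))))) 0<yf) ]′
        (toSum (f FinP.≟ e₀))
        where
        of : mach f ≡ m
        of = trans o om

      -- Away from `m` nothing changes. At `m` the load has not fallen, and a worse positive edge
      -- either was positive before or is `e₀`, whose own acceptance in `x` passes to the better
      -- ranked `e`. If `e` was saturated in `x`, it has been cut, and `cut⇒refused` applies.
      accepts-shrinks : ∀ {e} → e ≢ e₀ → y e < cap e → Accepts y e → x e < cap e × Accepts x e
      accepts-shrinks {e} e≢ y<cap accepting = [ at-m , away ]′ (toSum (mach e FinP.≟ m))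
        where
        away : mach e ≢ m → x e < cap e × Accepts x e
        away om = subst (_< cap e) (y≡x e refl) y<cap , accepts accepting
          where
          y≡x : ∀ f → mach f ≡ mach e → y f ≡ x f
          y≡x f of = y-away R≡0 f (λ { refl → om (sym of) }) (λ eq → om (trans (sym of) eq))
          accepts : Accepts y e → Accepts x e
          accepts (inj₁ l<q) = inj₁ (subst (_< qM (mach e))
            (sumIf-cong (M.at (mach e)) (λ f of → y≡x f (M.at-elim of))) l<q)
          accepts (inj₂ (f , of , 0<yf , r<)) = inj₂ (f , of , subst (0ℚ <_) (y≡x f of) 0<yf , r<)
        at-m : mach e ≡ m → x e < cap e × Accepts x e
        at-m om = [ (λ x<cap → x<cap) , (λ x≮cap → contradiction accepting (cut⇒refused om (0<loss x≮cap))) ]′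
            (toSum (x e <? cap e)) , accepts accepting
          where
          0<loss : ¬ (x e < cap e) → 0ℚ < RM.loss e
          0<loss x≮cap = [ (λ 0<l → 0<l) , (λ l≯0 → contradiction
            (subst (_< cap e) (trans (y-mach e≢ om) (trans (cong (λ l → x e - l)
              (0≤∧≮0⇒≡0 (M.cut-≥0 x 0≤x m RM.R e) l≯0)) (+-identityʳ (x e)))) y<cap) x≮cap) ]′ (toSum (0ℚ <? RM.loss e))
          accepts : Accepts y e → Accepts x e
          accepts (inj₁ l<q) = inj₁ (subst (λ k → loadM I x k < qM k) (sym om)
            (≤-<-trans (RM.load-grows 0≤A A≤roomM y balanceM) (subst (λ k → loadM I y k < qM k) om l<q)))
          accepts (inj₂ (f , of , 0<yf , r<)) =
            [ (λ { refl → better (proj₂ (proj₂ blocking)) r< })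
            , (λ f≢ → inj₂ (f , of , <-≤-trans 0<yf (y≤x f f≢) , r<)) ]′ (toSum (f FinP.≟ e₀))
            where
            better : Accepts x e₀ → rankM e ℕ.< rankM e₀ → Accepts x e
            better (inj₁ l<q) _ = inj₁ (subst (λ k → loadM I x k < qM k) (sym om) l<q)
            better (inj₂ (g , og , 0<xg , rg)) r< = inj₂ (g , trans og (sym om) , 0<xg , ℕP.<-trans r< rg)

    -- Let `e` block `y` and `f` be the worse positive edge. If `f` is not `e₀`, it was positive in
    -- `x`, so `e` either blocked `x` already or is `e₀`, which had no worse positive edge. If `f`
    -- is `e₀`, then `e` blocked `x` and is better than `e₀` for `j`, against the choice of `e₀`.
    settled-preserved : Settled x → Settled y
    settled-preserved settled e (y<cap , _ , accepts) (f , of , 0<yf , r<) =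
      [ raised , (λ f≢ → [ (λ { refl → ¬w₀ (w f≢) })
        , (λ e≢ → settled e (let (x<cap , ok) = shrink e≢ in x<cap , inj₂ (w f≢) , ok) (w f≢))
          ]′ (toSum (e FinP.≟ e₀))) ]′
      (toSum (f FinP.≟ e₀))
      where
      ¬w₀ : ¬ WorseJ x e₀
      ¬w₀ = settled e₀ blocking
      R≡0 : RJ.R ≡ 0ℚ
      R≡0 = ¬worse⇒R≡0 ¬w₀
      shrink : e ≢ e₀ → x e < cap e × Accepts R≡0 x e
      shrink e≢ = accepts-shrinks R≡0 e≢ y<cap accepts
      w : f ≢ e₀ → WorseJ x e
      w = worse-shrinks of 0<yf r<
      raised : f ≡ e₀ → ⊥
      raised refl = ℕP.<⇒≱ r< (proj₂ best₀ e (sym of) (proj₁ sh , wants (proj₁ (proj₂ blocking)) , proj₂ sh))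
        where
        sh = shrink (λ { refl → ℕP.<-irrefl refl r< })
        -- Whatever made `j` want `e₀` also makes it want the better edge `e`.
        wants : loadJ I x j < qJ j ⊎ WorseJ x e₀ → loadJ I x (job e) < qJ (job e) ⊎ WorseJ x e
        wants (inj₁ l<q) = inj₁ (subst (λ k → loadJ I x k < qJ k) of l<q)
        wants (inj₂ (g , og , 0<xg , rg)) = inj₂ (g , trans og of , 0<xg , ℕP.<-trans r< rg)

  -- Termination of both phases and their composition.

  module Terminates (s : ℕ) (cap-grid : ∀ e → OnGrid s (cap e))
    (qJ-grid : ∀ j → OnGrid s (qJ j)) (qM-grid : ∀ m → OnGrid s (qM m)) where

    State : Allocation I → Set
    State x = Feasible I x × (∀ e → OnGrid s (x e))

    module Respond (x : Allocation I) (state : State x) (e₀ : Fin nE) (best₀ : Best x e₀) where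
      open Step x (proj₁ state) e₀ (proj₁ best₀) public

      y-state : State y
      y-state = y-feasible , y-grid (proj₂ state) cap-grid qJ-grid qM-grid

      response : BRStep I x y
      response = e₀ , proj₁ best₀ , proj₂ best₀ , λ _ → refl

      regret-≺ : RJ.R ≡ 0ℚ → _≺_ {s} (regret y) (regret x)
      regret-≺ R≡0 = regret-≥0 y-feasible , regret-grid (proj₂ y-state) cap-grid , regret-grid (proj₂ state) cap-grid ,
        regret-< x (proj₁ state) e₀ (proj₁ best₀) R≡0

      jobPotential-≺ : jobPotential y < jobPotential x → _≺_ {s} (jobPotential y) (jobPotential x)
      jobPotential-≺ lt = jobPotential-≥0 y-feasible , jobPotential-grid (proj₂ y-state) cap-grid ,
        jobPotential-grid (proj₂ state) cap-grid , lt

      R≯0⇒regret-≺ : ¬ (0ℚ < RJ.R) → _≺_ {s} (regret y) (regret x)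
      R≯0⇒regret-≺ R≯0 = regret-≺ (0≤∧≮0⇒≡0 {RJ.R} RJ.R-≥0 R≯0)

    -- Regret breaks ties: a response that cuts at `j` lowers the job potential, and one that does
    -- not cut may leave it equal, but then lowers regret.
    _⊏_ : Allocation I → Allocation I → Set
    _⊏_ = ×-Lex _≡_ (_≺_ {s}) (_≺_ {s}) on (λ x → jobPotential x , regret x)

    ⊏-wellFounded : WellFounded _⊏_
    ⊏-wellFounded = On.wellFounded (λ x → jobPotential x , regret x)
      (×-wellFounded (≺-wellFounded {s}) (≺-wellFounded {s}))

    progress : ∀ x → State x → ∀ e → Blocks I x e → WorseJ x e →
      Σ (Allocation I) λ y → BRStep I x y × State y × y ⊏ x
    progress x state e b (f , of , 0<xf , r<) = respond (best e b)
      where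
      respond : (Σ (Fin nE) λ e₀ → job e₀ ≡ job e × rankJ e₀ ℕ.≤ rankJ e × Best x e₀) →
        Σ (Allocation I) λ y → BRStep I x y × State y × y ⊏ x
      respond (e₀ , o , r≤ , best₀) = y , response , y-state ,
        [ (λ 0<R → inj₁ (jobPotential-≺ (jobPotential-< x (proj₁ state) e₀ (proj₁ best₀) worse₀ 0<R)))
          , quota-suffices ]′
        (toSum (0ℚ <? RJ.R))
        where
        open Respond x state e₀ best₀
        worse₀ : WorseJ x e₀
        worse₀ = f , trans of (sym o) , 0<xf , ℕP.≤-<-trans r≤ r<
        quota-suffices : ¬ (0ℚ < RJ.R) → y ⊏ x
        quota-suffices R≯0 = [ (λ lt → inj₁ (jobPotential-≺ lt)) , (λ eq → inj₂ (eq , R≯0⇒regret-≺ R≯0)) ]′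
          (≤⇒<∨≡ {jobPotential y} {jobPotential x} (jobPotential-≤ x (proj₁ state) e₀ (proj₁ best₀) worse₀))

    settle : ∀ x → Acc _⊏_ x → State x → Σ (Allocation I) λ z → BRSteps I x z × State z × Settled z
    settle x (acc rs) state = [ respond , (λ none → x , ε , state , λ e b w → none (e , b , w)) ]′
      (toSum (FinP.any? (λ e → blocks? x e ×-dec worseJ? x e)))
      where
      respond : (Σ (Fin nE) λ e → Blocks I x e × WorseJ x e) →
        Σ (Allocation I) λ z → BRSteps I x z × State z × Settled z
      respond (e , b , w) =
        let (y , step , y-state , y⊏x) = progress x state e b w
            (z , steps , rest)         = settle y (rs y⊏x) y-state
        in z , step ◅ steps , rest

    -- On a settled allocation the best blocking edge has no worse positive edge, so nothing is cut
    -- at its job and regret alone measures progress; `settled-preserved` hands the invariant to the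
    -- recursive call.
    stabilise : ∀ x → Acc (_≺_ {s}) (regret x) → State x → Settled x →
      Σ (Allocation I) λ z → BRSteps I x z × Stable I z
    stabilise x (acc rt) state settled = [ (λ (e , b) → respond (best e b)) , (λ none → x , ε , λ e b → none (e , b)) ]′
      (toSum (FinP.any? (blocks? x)))
      where
      respond : ∀ {e} → (Σ (Fin nE) λ e₀ → job e₀ ≡ job e × rankJ e₀ ℕ.≤ rankJ e × Best x e₀) →
        Σ (Allocation I) λ z → BRSteps I x z × Stable I z
      respond (e₀ , _ , _ , best₀) =
        let open Respond x state e₀ best₀
            (z , steps , stable) = stabilise y
              (rt (regret-≺ (¬worse⇒R≡0 x (proj₁ state) e₀ best₀ (settled e₀ (proj₁ best₀))))) y-state
              (settled-preserved x (proj₁ state) e₀ best₀ settled)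
        in z , response ◅ steps , stable

    converge : ∀ x → State x → Σ (Allocation I) λ z → BRSteps I x z × Stable I z
    converge x state =
      let (y , steps , y-state , settled) = settle x (⊏-wellFounded x) state
          (z , steps′ , stable)           = stabilise y (≺-wellFounded (regret y)) y-state settled
      in z , steps ◅◅ steps′ , stable

theorem4 : (I : Instance) → WellFormed I → (x : Allocation I) → Feasible I x →
    Σ (Allocation I) (λ y → BRSteps I x y × Stable I y)
theorem4 I W x feasible =
  -- Scale `0` is the grid of the integers. Each family of data refines it in turn, and the `keep`
  -- maps bring the earlier families to the final grid.
  let (s₁ , _     , x-grid)   = common-grid x 0
      (s₂ , keep₂ , cap-grid) = common-grid (Instance.cap I) s₁
      (s₃ , keep₃ , qJ-grid)  = common-grid (Instance.qJ I) s₂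
      (s₄ , keep₄ , qM-grid)  = common-grid (Instance.qM I) s₃
  in Dynamics.Terminates.converge I W s₄
       (λ e → keep₄ (keep₃ (cap-grid e))) (λ j → keep₄ (qJ-grid j)) qM-grid
       x (feasible , λ e → keep₄ (keep₃ (keep₂ (x-grid e))))
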